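{- One has the disjoint union $\mathcal{P}_4=\mathcal{P}_{4,1}\sqcup\mathcal{P}_{4,2}$, and $$\mathcal{P}_4=\{s_2x^2+s_1x+s_0\colon s_0,s_1,s_2\in\mathbb{F}_4,\ s_1^3+s_2^3=1\},$$ where $$\mathcal{P}_{4,1}=\{s_1x+s_0\colon s_0,s_1\in\mathbb{F}_4,\ s_1^3=1\}\quad\text{and}\quad\mathcal{P}_{4,2}=\{s_2x^2+s_0\colon s_0,s_2\in\mathbb{F}_4,\ s_2^3=1\}.$$
   Context: $\mathbb{F}_4$ is the field with four elements. $\mathcal{P}_4$ is the set of polynomials in $\mathbb{F}_4[x]$ of degree less than $4$ that act as permutations of $\mathbb{F}_4$, and $\mathcal{P}_{4,d}$ is the subset of those of degree $d$. -}

module Defs where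

open import Level using (0ℓ)
open import Algebra.Apartness.Bundles using (HeytingField)
open import Algebra.Bundles using (CommutativeRing; Semiring)
import Algebra.Definitions.RawSemiring
open import Algebra.Structures using (IsCommutativeRing)
open import Data.List.Base using (List; []; _∷_; foldr)
open import Data.Nat.Base as ℕ using (ℕ; zero; suc)
open import Data.Product.Base using (_×_; _,_)
open import Function.Definitions using (Bijective)
open import Relation.Binary.Definitions using (DecidableEquality)
open import Relation.Binary.PropositionalEquality.Core using (_≡_; _≢_; refl; cong₂)
open import Relation.Binary.PropositionalEquality.Properties using (isEquivalence; decSetoid)
open import Relation.Nullary.Decidable using (Dec; yes; no; map′; _×-dec_; _→-dec_; ¬?; from-yes)
import Relation.Binary.Properties.DecSetoid as DecSetoidProperties
open import Relation.Unary using (Pred; Decidable)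

-- 𝔽₄ = 𝔽₂[ω]/(ω² + ω + 1), so the constructor ω² is both ω * ω and ω + 𝟙.

data 𝔽₄ : Set where
  𝟘 𝟙 ω ω² : 𝔽₄

infixl 6 _+_
infixl 7 _*_
infix  8 -_

_+_ : 𝔽₄ → 𝔽₄ → 𝔽₄
𝟘  + y  = y
𝟙  + 𝟘  = 𝟙
𝟙  + 𝟙  = 𝟘
𝟙  + ω  = ω²
𝟙  + ω² = ω
ω  + 𝟘  = ω
ω  + 𝟙  = ω²
ω  + ω  = 𝟘
ω  + ω² = 𝟙
ω² + 𝟘  = ω²
ω² + 𝟙  = ω
ω² + ω  = 𝟙
ω² + ω² = 𝟘

_*_ : 𝔽₄ → 𝔽₄ → 𝔽₄
𝟘  * y  = 𝟘
𝟙  * y  = y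
ω  * 𝟘  = 𝟘
ω  * 𝟙  = ω
ω  * ω  = ω²
ω  * ω² = 𝟙
ω² * 𝟘  = 𝟘
ω² * 𝟙  = ω²
ω² * ω  = 𝟙
ω² * ω² = ω

-- The characteristic is two.
-_ : 𝔽₄ → 𝔽₄
- x = x

infix 4 _≟_

_≟_ : DecidableEquality 𝔽₄
𝟘  ≟ 𝟘  = yes refl
𝟘  ≟ 𝟙  = no λ ()
𝟘  ≟ ω  = no λ ()
𝟘  ≟ ω² = no λ ()
𝟙  ≟ 𝟘  = no λ ()
𝟙  ≟ 𝟙  = yes refl
𝟙  ≟ ω  = no λ ()
𝟙  ≟ ω² = no λ ()
ω  ≟ 𝟘  = no λ ()
ω  ≟ 𝟙  = no λ ()
ω  ≟ ω  = yes refl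
ω  ≟ ω² = no λ ()
ω² ≟ 𝟘  = no λ ()
ω² ≟ 𝟙  = no λ ()
ω² ≟ ω  = no λ ()
ω² ≟ ω² = yes refl

all? : {P : Pred 𝔽₄ 0ℓ} → Decidable P → Dec (∀ x → P x)
all? {P} P? = map′ to from (P? 𝟘 ×-dec P? 𝟙 ×-dec P? ω ×-dec P? ω²)
  where
  to : P 𝟘 × P 𝟙 × P ω × P ω² → ∀ x → P x
  to (p , _ , _ , _) 𝟘  = p
  to (_ , p , _ , _) 𝟙  = p
  to (_ , _ , p , _) ω  = p
  to (_ , _ , _ , p) ω² = p

  from : (∀ x → P x) → P 𝟘 × P 𝟙 × P ω × P ω²
  from f = f 𝟘 , f 𝟙 , f ω , f ω²

isCommutativeRing : IsCommutativeRing _≡_ _+_ _*_ -_ 𝟘 𝟙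
isCommutativeRing = record
  { isRing = record
    { +-isAbelianGroup = record
      { isGroup = record
        { isMonoid = record
          { isSemigroup = record
            { isMagma = record { isEquivalence = isEquivalence ; ∙-cong = cong₂ _+_ }
            ; assoc = from-yes (all? λ x → all? λ y → all? λ z → (x + y) + z ≟ x + (y + z))
            }
          ; identity = (λ _ → refl) , from-yes (all? λ x → x + 𝟘 ≟ x)
          }
        ; inverse = from-yes (all? λ x → - x + x ≟ 𝟘) , from-yes (all? λ x → x + - x ≟ 𝟘)
        ; ⁻¹-cong = λ x≡y → x≡y
        }
      ; comm = from-yes (all? λ x → all? λ y → x + y ≟ y + x)
      }
    ; *-cong = cong₂ _*_
    ; *-assoc = from-yes (all? λ x → all? λ y → all? λ z → (x * y) * z ≟ x * (y * z))
    ; *-identity = (λ _ → refl) , from-yes (all? λ x → x * 𝟙 ≟ x)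
    ; distrib = from-yes (all? λ x → all? λ y → all? λ z → x * (y + z) ≟ x * y + x * z)
              , from-yes (all? λ x → all? λ y → all? λ z → (y + z) * x ≟ y * x + z * x)
    }
  ; *-comm = from-yes (all? λ x → all? λ y → x * y ≟ y * x)
  }

commutativeRing : CommutativeRing 0ℓ 0ℓ
commutativeRing = record { isCommutativeRing = isCommutativeRing }

infix 8 _⁻¹

_⁻¹ : 𝔽₄ → 𝔽₄
𝟘  ⁻¹ = 𝟘
𝟙  ⁻¹ = 𝟙
ω  ⁻¹ = ω²
ω² ⁻¹ = ω

heytingField : HeytingField 0ℓ 0ℓ 0ℓ
heytingField = record
  { _≈_ = _≡_
  ; _#_ = _≢_
  ; isHeytingField = record
    { isHeytingCommutativeRing = record
      { isCommutativeRing   = isCommutativeRing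
      ; isApartnessRelation = ≉-isApartnessRelation
      ; #⇒invertible = λ {x} {y} x≢y → (x + - y) ⁻¹ , ⁻¹-inverse x y x≢y
      ; invertible⇒# = λ { {x} (z , _ , [x-y]z≡1) refl → irrefl x z [x-y]z≡1 }
      }
    ; tight = ≉-tight
    }
  }
  where
  open DecSetoidProperties (decSetoid _≟_)

  ⁻¹-inverse : ∀ x y → x ≢ y →
               ((x + - y) ⁻¹ * (x + - y) ≡ 𝟙) × ((x + - y) * (x + - y) ⁻¹ ≡ 𝟙)
  ⁻¹-inverse = from-yes (all? λ x → all? λ y → ¬? (x ≟ y) →-dec
    (((x + - y) ⁻¹ * (x + - y) ≟ 𝟙) ×-dec ((x + - y) * (x + - y) ⁻¹ ≟ 𝟙)))

  irrefl : ∀ x z → (x + - x) * z ≢ 𝟙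
  irrefl = from-yes (all? λ x → all? λ z → ¬? ((x + - x) * z ≟ 𝟙))

open Algebra.Definitions.RawSemiring
  (Semiring.rawSemiring (CommutativeRing.semiring commutativeRing)) public
  using (_^_)

-- The list a₀ ∷ a₁ ∷ … ∷ aₙ ∷ [] represents a₀ + a₁x + … + aₙxⁿ. Trailing
-- zeros are allowed, so equality in 𝔽₄[x] is the relation _≈_ below rather
-- than _≡_; every notion below respects it.

𝔽₄[x] : Set
𝔽₄[x] = List 𝔽₄

coeff : 𝔽₄[x] → ℕ → 𝔽₄
coeff []      _       = 𝟘
coeff (a ∷ _) zero    = a
coeff (_ ∷ p) (suc n) = coeff p n

infix 4 _≈_

_≈_ : 𝔽₄[x] → 𝔽₄[x] → Set
p ≈ q = ∀ n → coeff p n ≡ coeff q n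

eval : 𝔽₄[x] → 𝔽₄ → 𝔽₄
eval p x = foldr (λ a v → a + x * v) 𝟘 p

HasDegree : ℕ → Pred 𝔽₄[x] 0ℓ
HasDegree d p = coeff p d ≢ 𝟘 × (∀ n → d ℕ.< n → coeff p n ≡ 𝟘)

-- Holds of the zero polynomial for every d, as with the convention deg 0 = -∞.
HasDegree< : ℕ → Pred 𝔽₄[x] 0ℓ
HasDegree< d p = ∀ n → d ℕ.≤ n → coeff p n ≡ 𝟘

𝒫₄ : Pred 𝔽₄[x] 0ℓ
𝒫₄ p = HasDegree< 4 p × Bijective _≡_ _≡_ (eval p)

𝒫₄,[_] : ℕ → Pred 𝔽₄[x] 0ℓ
𝒫₄,[ d ] p = 𝒫₄ p × HasDegree d p

{-# OPTIONS --safe #-}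
-- A polynomial of degree less than 4 is fixed by four coefficients, so injectivity
-- on 𝔽₄ is settled by inspecting all of them: exactly the a + bx and a + cx² with
-- b, c ≠ 𝟘 survive. Now x³ = 𝟙 for x ≠ 𝟘 and 𝟙 + 𝟙 = 𝟘, so b³ + c³ = 𝟙 says that
-- exactly one of b and c vanishes.
module Submission where

open import Defs
open import Level using (0ℓ)
open import Algebra.Bundles using (CommutativeRing)
open import Data.List.Base using ([]; _∷_; length)
open import Data.Nat.Base as ℕ using (zero; suc; z≤n; s≤s)
open import Data.Nat.Properties using (≤-trans; n≤1+n)
open import Data.Product.Base using (_×_; ∃-syntax; _,_; proj₁; proj₂)
open import Data.Sum.Base using (_⊎_; inj₁; inj₂; [_,_]; fromInj₁; fromInj₂; map)
open import Function.Base using (_∘_)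
open import Function.Consequences.Propositional using (inverseᵇ⇒bijective)
open import Function.Definitions using (Bijective)
open import Relation.Binary.PropositionalEquality.Core using (_≡_; _≢_; refl; sym; trans; cong; cong₂)
open import Relation.Nullary.Decidable using (_×-dec_; _⊎-dec_; _→-dec_; from-yes)
open import Relation.Nullary.Negation using (contradiction)
open import Relation.Unary using (Pred; _≐_; _∪_; _⊥_)

open CommutativeRing commutativeRing using (zeroʳ; +-identityʳ)

-- Related lists may differ in length. The surplus tail is then related to `[]`, so by induction it
-- evaluates to `𝟘`, and `zeroʳ` absorbs the factor `x`.
eval-cong : ∀ p q → p ≈ q → ∀ x → eval p x ≡ eval q x
eval-cong []      []      p≈q x = refl
eval-cong []      (b ∷ q) p≈q x = cong₂ _+_ (p≈q 0)
  (trans (sym (zeroʳ x)) (cong (x *_) (eval-cong [] q (p≈q ∘ suc) x)))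
eval-cong (a ∷ p) []      p≈q x = cong₂ _+_ (p≈q 0)
  (trans (cong (x *_) (eval-cong p [] (p≈q ∘ suc) x)) (zeroʳ x))
eval-cong (a ∷ p) (b ∷ q) p≈q x = cong₂ _+_ (p≈q 0)
  (cong (x *_) (eval-cong p q (p≈q ∘ suc) x))

HasDegree<-length : ∀ p → HasDegree< (length p) p
HasDegree<-length []      n       _         = refl
HasDegree<-length (a ∷ p) (suc n) (s≤s d≤n) = HasDegree<-length p n d≤n

HasDegree<-resp-≈ : ∀ d p q → p ≈ q → HasDegree< d q → HasDegree< d p
HasDegree<-resp-≈ d p q p≈q deg n d≤n = trans (p≈q n) (deg n d≤n)

HasDegree-resp-≈ : ∀ d p q → p ≈ q → HasDegree d q → HasDegree d p
HasDegree-resp-≈ d p q p≈q (lead≢𝟘 , deg) =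
  lead≢𝟘 ∘ trans (sym (p≈q d)) , HasDegree<-resp-≈ (suc d) p q p≈q deg

HasDegree-disjoint : ∀ {d e} → d ℕ.< e → HasDegree d ⊥ HasDegree e
HasDegree-disjoint d<e ((_ , deg) , (lead≢𝟘 , _)) = lead≢𝟘 (deg _ d<e)

truncate : ∀ p → HasDegree< 4 p →
           p ≈ (coeff p 0 ∷ coeff p 1 ∷ coeff p 2 ∷ coeff p 3 ∷ [])
truncate p deg 0 = refl
truncate p deg 1 = refl
truncate p deg 2 = refl
truncate p deg 3 = refl
truncate p deg (suc (suc (suc (suc n)))) = deg _ (s≤s (s≤s (s≤s (s≤s z≤n))))

cube≡𝟙⇒≢𝟘 : ∀ {s} → s ^ 3 ≡ 𝟙 → s ≢ 𝟘
cube≡𝟙⇒≢𝟘 () refl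

-- Decided by trying all 256 coefficient quadruples. Conceptually, the values of a permutation sum
-- to `𝟘`, whereas those of f sum to d, since x³ sums to `𝟙` over the field and lower powers to `𝟘`.
-- What remains, bx + cx², is additive, and its kernel is trivial only if exactly one of b and c is
-- nonzero.
injective-cubic : ∀ a b c d → let f = eval (a ∷ b ∷ c ∷ d ∷ []) in
  (∀ x y → f x ≡ f y → x ≡ y) →
  d ≡ 𝟘 × ((b ^ 3 ≡ 𝟙 × c ≡ 𝟘) ⊎ (c ^ 3 ≡ 𝟙 × b ≡ 𝟘))
injective-cubic = from-yes (all? λ a → all? λ b → all? λ c → all? λ d →
  let f = eval (a ∷ b ∷ c ∷ d ∷ []) in
  all? (λ x → all? λ y → (f x ≟ f y) →-dec (x ≟ y)) →-dec
  ((d ≟ 𝟘) ×-dec (((b ^ 3 ≟ 𝟙) ×-dec (c ≟ 𝟘)) ⊎-dec ((c ^ 3 ≟ 𝟙) ×-dec (b ≟ 𝟘)))))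

-- Squaring is its own inverse on 𝔽₄, so cx² is inverted by y ↦ (c⁻¹y)². As
-- 𝟘 ⁻¹ = 𝟘, the summand belonging to the vanishing coefficient drops out.
quadratic⁻¹ : 𝔽₄ → 𝔽₄ → 𝔽₄ → 𝔽₄ → 𝔽₄
quadratic⁻¹ a b c y = b ⁻¹ * (y + a) + (c ⁻¹ * (y + a)) ^ 2

-- Adding a removes the constant term in characteristic two; the condition on cubes leaves a single
-- monomial to invert.
quadratic-inverse : ∀ a b c → b ^ 3 + c ^ 3 ≡ 𝟙 → let f = eval (a ∷ b ∷ c ∷ []) in
  ∀ x → f (quadratic⁻¹ a b c x) ≡ x × quadratic⁻¹ a b c (f x) ≡ x
quadratic-inverse = from-yes (all? λ a → all? λ b → all? λ c →
  let f = eval (a ∷ b ∷ c ∷ []) in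
  (b ^ 3 + c ^ 3 ≟ 𝟙) →-dec
  all? λ x → (f (quadratic⁻¹ a b c x) ≟ x) ×-dec (quadratic⁻¹ a b c (f x) ≟ x))

Quadratic Linear PureQuadratic : Pred 𝔽₄[x] 0ℓ
Quadratic p = ∃[ s₀ ] ∃[ s₁ ] ∃[ s₂ ]
  ((s₁ ^ 3 + s₂ ^ 3 ≡ 𝟙) × (p ≈ (s₀ ∷ s₁ ∷ s₂ ∷ [])))
Linear p = ∃[ s₀ ] ∃[ s₁ ] ((s₁ ^ 3 ≡ 𝟙) × (p ≈ (s₀ ∷ s₁ ∷ [])))
PureQuadratic p = ∃[ s₀ ] ∃[ s₂ ] ((s₂ ^ 3 ≡ 𝟙) × (p ≈ (s₀ ∷ 𝟘 ∷ s₂ ∷ [])))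

Linear⇒Quadratic : ∀ p → Linear p → Quadratic p
Linear⇒Quadratic p (a , b , b³≡𝟙 , p≈q) =
  a , b , 𝟘 , trans (+-identityʳ _) b³≡𝟙 , p≈
  where
  -- A trailing `𝟘` changes no coefficient, but `coeff` reduces only once the index is split.
  p≈ : p ≈ (a ∷ b ∷ 𝟘 ∷ [])
  p≈ 0 = p≈q 0
  p≈ 1 = p≈q 1
  p≈ 2 = p≈q 2
  p≈ (suc (suc (suc n))) = p≈q (suc (suc (suc n)))

PureQuadratic⇒Quadratic : ∀ p → PureQuadratic p → Quadratic p
-- `𝟘 ^ 3 + c ^ 3` computes to `c ^ 3`, because `_+_` matches on its left argument first.
PureQuadratic⇒Quadratic p (a , c , c³≡𝟙 , p≈q) = a , 𝟘 , c , c³≡𝟙 , p≈q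

Quadratic⇒𝒫₄ : ∀ p → Quadratic p → 𝒫₄ p
Quadratic⇒𝒫₄ p (a , b , c , b³+c³≡𝟙 , p≈q) = degree , bijective
  where
  q : 𝔽₄[x]
  q = a ∷ b ∷ c ∷ []

  degree : HasDegree< 4 p
  degree n 4≤n = HasDegree<-resp-≈ 3 p q p≈q (HasDegree<-length q) n (≤-trans (n≤1+n 3) 4≤n)

  inverse : ∀ x → eval p (quadratic⁻¹ a b c x) ≡ x × quadratic⁻¹ a b c (eval p x) ≡ x
  inverse x with invˡ , invʳ ← quadratic-inverse a b c b³+c³≡𝟙 x =
    trans (eval-cong p q p≈q _) invˡ ,
    trans (cong (quadratic⁻¹ a b c) (eval-cong p q p≈q x)) invʳ

  bijective : Bijective _≡_ _≡_ (eval p)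
  bijective = inverseᵇ⇒bijective
    ((λ { refl → proj₁ (inverse _) }) , (λ { refl → proj₂ (inverse _) }))

𝒫₄⇒Linear⊎PureQuadratic : ∀ p → 𝒫₄ p → Linear p ⊎ PureQuadratic p
𝒫₄⇒Linear⊎PureQuadratic p (deg , inj , _) = map linear pureQuadratic (proj₂ shape)
  where
  a b c d : 𝔽₄
  a = coeff p 0
  b = coeff p 1
  c = coeff p 2
  d = coeff p 3

  q : 𝔽₄[x]
  q = a ∷ b ∷ c ∷ d ∷ []

  p≈q : p ≈ q
  p≈q = truncate p deg

  shape : d ≡ 𝟘 × ((b ^ 3 ≡ 𝟙 × c ≡ 𝟘) ⊎ (c ^ 3 ≡ 𝟙 × b ≡ 𝟘))
  -- The exhaustive check speaks of four-term lists, so injectivity is transported from `p` to its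
  -- truncation `q`.
  shape = injective-cubic a b c d λ x y qx≡qy →
    inj (trans (eval-cong p q p≈q x) (trans qx≡qy (sym (eval-cong p q p≈q y))))

  linear : b ^ 3 ≡ 𝟙 × c ≡ 𝟘 → Linear p
  linear (b³≡𝟙 , c≡𝟘) = a , b , b³≡𝟙 , λ where
    0 → refl
    1 → refl
    2 → c≡𝟘
    3 → proj₁ shape
    (suc (suc (suc (suc n)))) → p≈q (suc (suc (suc (suc n))))

  pureQuadratic : c ^ 3 ≡ 𝟙 × b ≡ 𝟘 → PureQuadratic p
  pureQuadratic (c³≡𝟙 , b≡𝟘) = a , c , c³≡𝟙 , λ where
    0 → refl
    1 → b≡𝟘
    2 → refl
    3 → proj₁ shape
    (suc (suc (suc (suc n)))) → p≈q (suc (suc (suc (suc n))))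

Linear⇒𝒫₄,[1] : ∀ p → Linear p → 𝒫₄,[ 1 ] p
Linear⇒𝒫₄,[1] p l@(a , b , b³≡𝟙 , p≈q) =
  Quadratic⇒𝒫₄ p (Linear⇒Quadratic p l) ,
  HasDegree-resp-≈ 1 p q p≈q (cube≡𝟙⇒≢𝟘 b³≡𝟙 , HasDegree<-length q)
  where
  q : 𝔽₄[x]
  q = a ∷ b ∷ []

PureQuadratic⇒𝒫₄,[2] : ∀ p → PureQuadratic p → 𝒫₄,[ 2 ] p
PureQuadratic⇒𝒫₄,[2] p l@(a , c , c³≡𝟙 , p≈q) =
  Quadratic⇒𝒫₄ p (PureQuadratic⇒Quadratic p l) ,
  HasDegree-resp-≈ 2 p q p≈q (cube≡𝟙⇒≢𝟘 c³≡𝟙 , HasDegree<-length q)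
  where
  q : 𝔽₄[x]
  q = a ∷ 𝟘 ∷ c ∷ []

𝒫₄⇒𝒫₄,[1]⊎𝒫₄,[2] : ∀ p → 𝒫₄ p → 𝒫₄,[ 1 ] p ⊎ 𝒫₄,[ 2 ] p
𝒫₄⇒𝒫₄,[1]⊎𝒫₄,[2] p =
  map (Linear⇒𝒫₄,[1] p) (PureQuadratic⇒𝒫₄,[2] p) ∘ 𝒫₄⇒Linear⊎PureQuadratic p

𝒫₄,[1]⊥𝒫₄,[2] : 𝒫₄,[ 1 ] ⊥ 𝒫₄,[ 2 ]
𝒫₄,[1]⊥𝒫₄,[2] {p} ((_ , deg₁) , (_ , deg₂)) =
  HasDegree-disjoint (s≤s (s≤s z≤n)) {p} (deg₁ , deg₂)

𝒫₄⇒Quadratic : ∀ p → 𝒫₄ p → Quadratic p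
𝒫₄⇒Quadratic p =
  [ Linear⇒Quadratic p , PureQuadratic⇒Quadratic p ] ∘ 𝒫₄⇒Linear⊎PureQuadratic p

-- The pure quadratic alternative would give `p` degree 2 as well as 1, against disjointness. The
-- degree 2 case excludes the linear one in the same way.
𝒫₄,[1]⇒Linear : ∀ p → 𝒫₄,[ 1 ] p → Linear p
𝒫₄,[1]⇒Linear p p∈₁ = fromInj₁
  (λ l → contradiction (p∈₁ , PureQuadratic⇒𝒫₄,[2] p l) (𝒫₄,[1]⊥𝒫₄,[2] {p}))
  (𝒫₄⇒Linear⊎PureQuadratic p (proj₁ p∈₁))

𝒫₄,[2]⇒PureQuadratic : ∀ p → 𝒫₄,[ 2 ] p → PureQuadratic p
𝒫₄,[2]⇒PureQuadratic p p∈₂ = fromInj₂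
  (λ l → contradiction (Linear⇒𝒫₄,[1] p l , p∈₂) (𝒫₄,[1]⊥𝒫₄,[2] {p}))
  (𝒫₄⇒Linear⊎PureQuadratic p (proj₁ p∈₂))

proposition3p1 : (𝒫₄ ≐ 𝒫₄,[ 1 ] ∪ 𝒫₄,[ 2 ]) × (𝒫₄,[ 1 ] ⊥ 𝒫₄,[ 2 ])
    × (𝒫₄ ≐ λ p → ∃[ s₀ ] ∃[ s₁ ] ∃[ s₂ ]
    ((s₁ ^ 3 + s₂ ^ 3 ≡ 𝟙) × (p ≈ (s₀ ∷ s₁ ∷ s₂ ∷ []))))
    × (𝒫₄,[ 1 ] ≐ λ p → ∃[ s₀ ] ∃[ s₁ ]
    ((s₁ ^ 3 ≡ 𝟙) × (p ≈ (s₀ ∷ s₁ ∷ []))))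
    × (𝒫₄,[ 2 ] ≐ λ p → ∃[ s₀ ] ∃[ s₂ ]
    ((s₂ ^ 3 ≡ 𝟙) × (p ≈ (s₀ ∷ 𝟘 ∷ s₂ ∷ []))))
proposition3p1 =
    ((λ {p} → 𝒫₄⇒𝒫₄,[1]⊎𝒫₄,[2] p) , [ proj₁ , proj₁ ])
  , (λ {p} → 𝒫₄,[1]⊥𝒫₄,[2] {p})
  , ((λ {p} → 𝒫₄⇒Quadratic p) , λ {p} → Quadratic⇒𝒫₄ p)
  , ((λ {p} → 𝒫₄,[1]⇒Linear p) , λ {p} → Linear⇒𝒫₄,[1] p)
  , ((λ {p} → 𝒫₄,[2]⇒PureQuadratic p) , λ {p} → PureQuadratic⇒𝒫₄,[2] p)
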